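{- The relation $E^{\mathrm{ce}}_0$ is weak; that is, every equivalence relation $F^{\mathrm{ce}}$ on $\omega$ with $F^{\mathrm{ce}}\supseteq E^{\mathrm{ce}}_0$ that is universal is equal to $\mathrm{Id}_1$.
   Context: Fix a standard (acceptable) enumeration $(\varphi_e)_{e\in\omega}$ of the partial computable functions and let $W_e=\operatorname{dom}(\varphi_e)$. Write $e=^{\mathrm{ce}}e'$ iff $W_e=W_{e'}$, and $e\mathrel{E^{\mathrm{ce}}_0}e'$ iff the symmetric difference $W_e\mathbin{\triangle}W_{e'}$ is finite. $\mathrm{Id}_1$ is the one-class equivalence relation on $\omega$. An enumeration of a set $A$ is a surjection $\mu:\omega\to A$; $\mu[s]$ denotes the finite string $\mu(0),\dots,\mu(s-1)$. A learner is an arbitrary function $\mathbf{M}:\omega^{<\omega}\to\omega$ (no effectivity is assumed). For an equivalence relation $E^{\mathrm{ce}}$ on $\omega$ extending $=^{\mathrm{ce}}$, a family $\mathfrak{K}$ of nonempty c.e. sets is $E^{\mathrm{ce}}$-learnable if there is a learner $\mathbf{M}$ such that for every $e$ with $W_e\in\mathfrak{K}$ and every enumeration $\mu$ of $W_e$ there is $i\in\omega$ with $i\mathrel{E^{\mathrm{ce}}}e$ and $\mathbf{M}(\mu[s])=i$ for all sufficiently large $s$. $E^{\mathrm{ce}}$ is universal if every family of nonempty c.e. sets is $E^{\mathrm{ce}}$-learnable. An equivalence relation $E^{\mathrm{ce}}$ on $\omega$ extending $=^{\mathrm{ce}}$ is weak if every equivalence relation $F^{\mathrm{ce}}\supseteq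 E^{\mathrm{ce}}$ that is universal is equal to $\mathrm{Id}_1$. -}

module Defs where

open import Level using (Level; 0ℓ; _⊔_) renaming (suc to lsuc)
open import Data.Empty using (⊥-elim)
open import Data.Fin using (Fin)
open import Data.List using (List; []; _++_; applyUpTo)
open import Data.List.Membership.Propositional using () renaming (_∈_ to _∈ˡ_)
open import Data.List.Membership.Propositional.Properties using (∈-++⁺ˡ; ∈-++⁺ʳ)
open import Data.List.Membership.DecPropositional using (_∈?_)
open import Data.Nat using (ℕ; zero; suc; _≤_; _<_; _≟_)
open import Data.Product using (∃; ∃-syntax; _×_; _,_)
open import Data.Sum using (inj₁; inj₂)
import Data.Sum as Sum
open import Data.Unit using (⊤; tt)
open import Data.Vec using (Vec; []; _∷_; lookup)
open import Data.Vec.Relation.Binary.Pointwise.Inductive using (Pointwise)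
open import Relation.Binary using (Rel; REL; IsEquivalence; _⇒_; _⇔_)
open import Relation.Binary.PropositionalEquality using (_≡_)
open import Relation.Nullary using (¬_; yes; no)
open import Relation.Unary using (Pred; _∈_; _⊆_; _≐_; _∪_; _∖_; Satisfiable)

-- Partial computable functions are presented as the partial μ-recursive
-- functions; a partial function is given by its graph.

data Rec : ℕ → Set where
  zeroᵣ : Rec 0
  sucᵣ  : Rec 1
  proj  : ∀ {n} → Fin n → Rec n
  comp  : ∀ {m n} → Rec m → Vec (Rec n) m → Rec n
  prec  : ∀ {n} → Rec n → Rec (suc (suc n)) → Rec (suc n)
  min   : ∀ {n} → Rec (suc n) → Rec n

infix 4 _[_]⇓_

data _[_]⇓_ : ∀ {n} → Rec n → Vec ℕ n → ℕ → Set where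
  ⇓zero  : zeroᵣ [ [] ]⇓ zero
  ⇓suc   : ∀ {x} → sucᵣ [ x ∷ [] ]⇓ suc x
  ⇓proj  : ∀ {n} {i : Fin n} {xs} → proj i [ xs ]⇓ lookup xs i
  ⇓comp  : ∀ {m n} {f : Rec m} {gs : Vec (Rec n) m} {xs ys z} →
           Pointwise (λ g y → g [ xs ]⇓ y) gs ys →
           f [ ys ]⇓ z →
           comp f gs [ xs ]⇓ z
  ⇓prec₀ : ∀ {n} {f : Rec n} {g xs y} →
           f [ xs ]⇓ y →
           prec f g [ zero ∷ xs ]⇓ y
  ⇓prec₊ : ∀ {n} {f : Rec n} {g xs k r y} →
           prec f g [ k ∷ xs ]⇓ r →
           g [ k ∷ r ∷ xs ]⇓ y →
           prec f g [ suc k ∷ xs ]⇓ y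
  ⇓min   : ∀ {n} {f : Rec (suc n)} {xs k} →
           f [ k ∷ xs ]⇓ zero →
           (∀ {j} → j < k → ∃[ r ] f [ j ∷ xs ]⇓ suc r) →
           min f [ xs ]⇓ k

graph₁ : Rec 1 → REL ℕ ℕ 0ℓ
graph₁ p x y = p [ x ∷ [] ]⇓ y

graph₂ : Rec 2 → ℕ → REL ℕ ℕ 0ℓ
graph₂ p e x y = p [ e ∷ x ∷ [] ]⇓ y

Computable : (ℕ → ℕ) → Set
Computable f = ∃[ p ] ∀ x → graph₁ p x (f x)

-- Acceptability in the sense of Rogers: a universal machine and
-- an s-m-n function.  `φ e` is the graph of the e-th partial function.
record AcceptableEnumeration : Set₁ where
  field
    φ         : ℕ → REL ℕ ℕ 0ℓ
    universal : ∃[ u ] ∀ e → φ e ⇔ graph₂ u e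
    complete  : ∀ p → ∃[ e ] φ e ⇔ graph₁ p
    smn       : ∀ p → ∃[ s ] Computable s × (∀ e → φ (s e) ⇔ graph₂ p e)

infixl 6 _△_

_△_ : Pred ℕ 0ℓ → Pred ℕ 0ℓ → Pred ℕ 0ℓ
A △ B = (A ∖ B) ∪ (B ∖ A)

-- A is contained in a finite list.  Asking for a list of exactly the elements
-- of A is classically equivalent, but constructively that would in addition
-- decide membership in A.
Finite : Pred ℕ 0ℓ → Set
Finite A = ∃[ xs ] (∀ {x} → x ∈ A → x ∈ˡ xs)

record IsEnumeration (μ : ℕ → ℕ) (A : Pred ℕ 0ℓ) : Set where
  field
    into : ∀ n → μ n ∈ A
    onto : ∀ {x} → x ∈ A → ∃[ n ] μ n ≡ x

Learner : Set
Learner = List ℕ → ℕ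

module _ (N : AcceptableEnumeration) where
  open AcceptableEnumeration N

  W : ℕ → Pred ℕ 0ℓ
  W e x = ∃[ y ] φ e x y

  IsCE : Pred ℕ 0ℓ → Set
  IsCE A = ∃[ e ] A ≐ W e

  _=ᶜᵉ_ : Rel ℕ 0ℓ
  e =ᶜᵉ e′ = W e ≐ W e′

  record CERelation (ℓ : Level) : Set (lsuc ℓ) where
    field
      rel           : Rel ℕ ℓ
      isEquivalence : IsEquivalence rel
      extends       : _=ᶜᵉ_ ⇒ rel

  open CERelation

  -- Sets are predicates up to mutual inclusion, hence `resp`.
  record Family : Set₁ where
    field
      member   : Pred (Pred ℕ 0ℓ) 0ℓ
      resp     : ∀ {A B} → A ≐ B → member A → member B
      ce       : ∀ {A} → member A → IsCE A
      nonempty : ∀ {A} → member A → Satisfiable A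

  open Family

  Learnable : ∀ {ℓ} → CERelation ℓ → Family → Set ℓ
  Learnable E K =
    ∃ λ (M : Learner) →
      ∀ e → member K (W e) →
      ∀ μ → IsEnumeration μ (W e) →
      ∃[ i ] rel E i e × (∃[ s₀ ] ∀ s → s₀ ≤ s → M (applyUpTo μ s) ≡ i)

  Universal : ∀ {ℓ} → CERelation ℓ → Set (lsuc 0ℓ ⊔ ℓ)
  Universal E = ∀ K → Learnable E K

  Id₁ : CERelation 0ℓ
  Id₁ = record
    { rel           = λ _ _ → ⊤
    ; isEquivalence = record
      { refl = tt ; sym = λ _ → tt ; trans = λ _ _ → tt }
    ; extends       = λ _ → tt
    }

  -- ℓ is the universe level in which the coarser relations F take values.
  Weak : ∀ {ℓ′} (ℓ : Level) → CERelation ℓ′ → Set (lsuc 0ℓ ⊔ lsuc ℓ ⊔ ℓ′)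
  Weak ℓ E = ∀ (F : CERelation ℓ) → rel E ⇒ rel F → Universal F → rel F ⇔ rel Id₁

  _E₀_ : Rel ℕ 0ℓ
  e E₀ e′ = Finite (W e △ W e′)

  private
    E₀-extends : _=ᶜᵉ_ ⇒ _E₀_
    E₀-extends (p , q) = [] , λ where
      (inj₁ (x∈ , x∉)) → ⊥-elim (x∉ (p x∈))
      (inj₂ (x∈ , x∉)) → ⊥-elim (x∉ (q x∈))

    △-cover : ∀ {A B C : Pred ℕ 0ℓ} xs ys →
              (∀ {x} → x ∈ A △ B → x ∈ˡ xs) →
              (∀ {x} → x ∈ B △ C → x ∈ˡ ys) →
              ∀ {x} → x ∈ A ∖ C → x ∈ˡ (xs ++ ys)
    △-cover xs ys p q {x} (a , ¬c) with _∈?_ _≟_ x ys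
    ... | yes x∈ys = ∈-++⁺ʳ xs x∈ys
    ... | no  x∉ys = ∈-++⁺ˡ (p (inj₁ (a , λ b → x∉ys (q (inj₁ (b , ¬c))))))

    E₀-sym : ∀ {e e′} → e E₀ e′ → e′ E₀ e
    E₀-sym (xs , p) = xs , λ z → p (Sum.swap z)

    E₀-trans : ∀ {e₁ e₂ e₃} → e₁ E₀ e₂ → e₂ E₀ e₃ → e₁ E₀ e₃
    E₀-trans {e₁} {e₂} {e₃} (xs , p) (ys , q) =
      (xs ++ ys) ++ (ys ++ xs) , λ where
        (inj₁ z) → ∈-++⁺ˡ
          (△-cover {W e₁} {W e₂} {W e₃} xs ys p q z)
        (inj₂ z) → ∈-++⁺ʳ (xs ++ ys)
          (△-cover {W e₃} {W e₂} {W e₁} ys xs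
            (λ w → q (Sum.swap w)) (λ w → p (Sum.swap w)) z)

  E₀ᶜᵉ : CERelation 0ℓ
  E₀ᶜᵉ = record
    { rel           = _E₀_
    ; isEquivalence = record
      { refl  = λ {e} → E₀-extends {e} {e} ((λ z → z) , (λ z → z))
      ; sym   = λ {e} {e′} → E₀-sym {e} {e′}
      ; trans = λ {e₁} {e₂} {e₃} → E₀-trans {e₁} {e₂} {e₃}
      }
    ; extends       = λ {e} {e′} → E₀-extends {e} {e′}
    }

{-# OPTIONS --safe #-}

-- Every c.e. set differs finitely from one containing 0, so fix a c.e. set B
-- containing 0 and a learner M for the family of all nonempty c.e. sets.
-- Enumerate B while fooling M: having listed a finite ρ ⊆ B, keep repeating 0.
-- This looks like an enumeration of the finite set {0} ∪ ρ, so M eventually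
-- names an index F-equivalent to that finite set, hence, as F ⊇ E₀, to the empty
-- set; only then list more elements of B.  In the limit B is enumerated, and the
-- index on which M settles is F-equivalent both to B and to the empty set.

module Submission where

open import Defs
open import Level using (Level; 0ℓ)
open import Data.Bool using (Bool; T)
open import Data.Bool.Properties using (T?)
open import Data.Empty using (⊥-elim)
open import Data.Fin using (zero; suc)
open import Data.List using (List; []; _∷_; _++_; applyUpTo; length; filter; upTo)
open import Data.List.Properties using (length-applyUpTo; length-++-≤ˡ)
open import Data.List.Membership.Propositional using () renaming (_∈_ to _∈ˡ_)
open import Data.List.Membership.Propositional.Properties
  using (∈-++⁺ˡ; ∈-++⁺ʳ; ∈-filter⁺; ∈-filter⁻; ∈-upTo⁺)
open import Data.List.Relation.Unary.All as All using (All; []; _∷_)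
import Data.List.Relation.Unary.All.Properties as All
open import Data.List.Relation.Unary.Any using (here; there)
open import Data.Maybe using (Maybe; just; nothing; _>>=_; is-just)
open import Data.Nat using (ℕ; zero; suc; _+_; _≤_; _<_; _⊔_; z≤n; s≤s)
open import Data.Nat.Properties
  using (≤-refl; ≤-trans; ≤-<-trans; <-≤-trans; ≤-total; m≤m⊔n; m≤n⊔m; m⊔n≤o⇒m≤o; m⊔n≤o⇒n≤o;
         m<n⇒m<1+n; m≤n⇒m<n∨m≡n; +-suc; +-identityʳ; +-comm; n<1+n; m≤n+m; m≤n⇒∃[o]m+o≡n;
         <⇒≤; <-trans)
open import Data.Product using (∃-syntax; _×_; _,_; proj₁; proj₂)
open import Data.Sum using (_⊎_; inj₁; inj₂)
open import Data.Unit using (tt)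
open import Data.Vec using (Vec; []; _∷_; lookup)
open import Data.Vec.Relation.Binary.Pointwise.Inductive using (Pointwise; []; _∷_)
open import Relation.Binary using (IsEquivalence; _⇒_)
open import Relation.Binary.PropositionalEquality using (_≡_; refl; sym; trans; cong; cong₂; subst)
open import Relation.Nullary using (¬_)
open import Relation.Unary using (Pred; _∈_; _⊆_; _≐_; Satisfiable)

-- Programs for finite sets and for adjoining one element.

Dom : Rec 1 → Pred ℕ 0ℓ
Dom p x = ∃[ y ] graph₁ p x y

constᵣ : ∀ {n} → ℕ → Rec n
constᵣ zero    = comp zeroᵣ []
constᵣ (suc k) = comp sucᵣ (constᵣ k ∷ [])

⇓const : ∀ {n} k {xs : Vec ℕ n} → constᵣ k [ xs ]⇓ k
⇓const zero    = ⇓comp [] ⇓zero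
⇓const (suc k) = ⇓comp (⇓const k ∷ []) ⇓suc

const⇓ : ∀ {n} k {xs : Vec ℕ n} {y} → constᵣ k [ xs ]⇓ y → y ≡ k
const⇓ zero    (⇓comp [] ⇓zero)       = refl
const⇓ (suc k) (⇓comp (d ∷ []) ⇓suc) = cong suc (const⇓ k d)

-- Vanishes exactly at d.
distinctᵣ : ℕ → Rec 1
distinctᵣ zero    = prec zeroᵣ (constᵣ 1)
-- The step reads only the counter, so this recursion is a mere case split on zero.
distinctᵣ (suc d) = prec (constᵣ 1) (comp (distinctᵣ d) (proj zero ∷ []))

-- A derivation for `prec` at a successor contains one for the predecessor even if the step ignores
-- its value, so convergence there must be known first.
distinct-total : ∀ d x → x ∈ Dom (distinctᵣ d)
distinct-total zero    zero    = _ , ⇓prec₀ ⇓zero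
distinct-total zero    (suc x) = _ , ⇓prec₊ (proj₂ (distinct-total zero x)) (⇓const 1)
distinct-total (suc d) zero    = _ , ⇓prec₀ (⇓const 1)
distinct-total (suc d) (suc x) =
  _ , ⇓prec₊ (proj₂ (distinct-total (suc d) x)) (⇓comp (⇓proj ∷ []) (proj₂ (distinct-total d x)))

distinct-diag : ∀ d → graph₁ (distinctᵣ d) d 0
distinct-diag zero    = ⇓prec₀ ⇓zero
distinct-diag (suc d) =
  ⇓prec₊ (proj₂ (distinct-total (suc d) d)) (⇓comp (⇓proj ∷ []) (distinct-diag d))

distinct-zero : ∀ d {x} → graph₁ (distinctᵣ d) x 0 → x ≡ d
distinct-zero zero    (⇓prec₀ ⇓zero) = refl
distinct-zero zero    (⇓prec₊ _ q) with () ← const⇓ 1 q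
distinct-zero (suc d) (⇓prec₀ q) with () ← const⇓ 1 q
distinct-zero (suc d) (⇓prec₊ _ (⇓comp (⇓proj ∷ []) q)) = cong suc (distinct-zero d q)

-- Primitive recursion does not evaluate its step at 0, so p runs only if x ≢ d.
guardᵣ : Rec 1 → Rec 2
guardᵣ p = prec (constᵣ 0) (comp p (proj (suc (suc zero)) ∷ []))

insertᵣ : ℕ → Rec 1 → Rec 1
insertᵣ d p = comp (guardᵣ p) (distinctᵣ d ∷ proj zero ∷ [])

guard-defined : ∀ {p x} → x ∈ Dom p → ∀ k → ∃[ y ] guardᵣ p [ k ∷ x ∷ [] ]⇓ y
guard-defined _         zero    = _ , ⇓prec₀ (⇓const 0)
guard-defined x∈p@(_ , q) (suc k) =
  _ , ⇓prec₊ (proj₂ (guard-defined x∈p k)) (⇓comp (⇓proj ∷ []) q)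

insert-self : ∀ d p → d ∈ Dom (insertᵣ d p)
insert-self d p = _ , ⇓comp (distinct-diag d ∷ ⇓proj ∷ []) (⇓prec₀ (⇓const 0))

insert-old : ∀ d {p} → Dom p ⊆ Dom (insertᵣ d p)
insert-old d {p} {x} x∈p with z , q ← distinct-total d x =
  _ , ⇓comp (q ∷ ⇓proj ∷ []) (proj₂ (guard-defined x∈p z))

insert⁻ : ∀ d {p x} → x ∈ Dom (insertᵣ d p) → x ≡ d ⊎ x ∈ Dom p
insert⁻ d (_ , ⇓comp (q ∷ ⇓proj ∷ []) (⇓prec₀ _)) = inj₁ (distinct-zero d q)
insert⁻ d (_ , ⇓comp (_ ∷ ⇓proj ∷ []) (⇓prec₊ _ (⇓comp (⇓proj ∷ []) r))) = inj₂ (_ , r)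

listᵣ : List ℕ → Rec 1
-- Searching for a zero of the constant 1 never halts, so the domain is empty.
listᵣ []       = min (constᵣ 1)
listᵣ (d ∷ ds) = insertᵣ d (listᵣ ds)

list⁺ : ∀ {ds} → (_∈ˡ ds) ⊆ Dom (listᵣ ds)
list⁺ {d ∷ ds} (here refl) = insert-self d (listᵣ ds)
list⁺ {d ∷ ds} (there x∈)  = insert-old d (list⁺ x∈)

list⁻ : ∀ ds → Dom (listᵣ ds) ⊆ (_∈ˡ ds)
list⁻ []       (_ , ⇓min q _) with () ← const⇓ 1 q
list⁻ (d ∷ ds) x∈ with insert⁻ d x∈
... | inj₁ refl = here refl
... | inj₂ x∈ds = there (list⁻ ds x∈ds)

-- Fuel-bounded evaluation and its soundness.

-- The fuel s bounds only the search in `min`.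

search : (ℕ → Maybe ℕ) → ℕ → ℕ → Maybe ℕ
search f zero    j = nothing
search f (suc s) j = f j >>= λ where
  zero    → just j
  (suc _) → search f s (suc j)

mutual
  eval : ∀ {n} → ℕ → Rec n → Vec ℕ n → Maybe ℕ
  eval s zeroᵣ       []           = just 0
  eval s sucᵣ        (x ∷ [])     = just (suc x)
  eval s (proj i)    xs           = just (lookup xs i)
  eval s (comp f gs) xs           = evals s gs xs >>= eval s f
  eval s (prec f g)  (zero ∷ xs)  = eval s f xs
  eval s (prec f g)  (suc k ∷ xs) = eval s (prec f g) (k ∷ xs) >>= λ r → eval s g (k ∷ r ∷ xs)
  eval s (min f)     xs           = search (λ k → eval s f (k ∷ xs)) s 0

  evals : ∀ {m n} → ℕ → Vec (Rec n) m → Vec ℕ n → Maybe (Vec ℕ m)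
  evals s []       xs = just []
  evals s (g ∷ gs) xs = eval s g xs >>= λ y → evals s gs xs >>= λ ys → just (y ∷ ys)

>>=-just⁻ : ∀ {A B : Set} (m : Maybe A) {f : A → Maybe B} {y} →
            (m >>= f) ≡ just y → ∃[ x ] m ≡ just x × f x ≡ just y
>>=-just⁻ (just x) eq = x , refl , eq

>>=-just⁺ : ∀ {A B : Set} {m : Maybe A} {f : A → Maybe B} {x y} →
            m ≡ just x → f x ≡ just y → (m >>= f) ≡ just y
>>=-just⁺ refl eq = eq

-- The hypothesis on `i < j` is the loop invariant: the indices already passed gave positive values.
-- It is vacuous at the initial `j = 0`.
search-sound : ∀ f s j {k} → search f s j ≡ just k →
               (∀ {i} → i < j → ∃[ r ] f i ≡ just (suc r)) →
               f k ≡ just 0 × (∀ {i} → i < k → ∃[ r ] f i ≡ just (suc r))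
search-sound f (suc s) j eq below with >>=-just⁻ (f j) eq
... | zero  , fj , refl = fj , below
... | suc r , fj , eq′  = search-sound f s (suc j) eq′ below′
  where
  below′ : ∀ {i} → i < suc j → ∃[ r ] f i ≡ just (suc r)
  below′ (s≤s i≤j) with m≤n⇒m<n∨m≡n i≤j
  ... | inj₁ i<j  = below i<j
  ... | inj₂ refl = r , fj

-- Induction on the distance `d` from the current index to the zero. Each of the `d + 1` tests costs
-- one unit of fuel, whence `d < s`.
search-complete : ∀ f {k} → f k ≡ just 0 → (∀ {i} → i < k → ∃[ r ] f i ≡ just (suc r)) →
                  ∀ d j → d + j ≡ k → ∀ s → d < s → search f s j ≡ just k
search-complete f fk below zero    j refl (suc s) _ = >>=-just⁺ fk refl
search-complete f {k} fk below (suc d) j eq (suc s) (s≤s d<s) =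
  >>=-just⁺ (proj₂ (below j<k)) (search-complete f fk below d (suc j) eq′ s d<s)
  where
  eq′ : d + suc j ≡ k
  eq′ = trans (+-suc d j) eq
  j<k : j < k
  j<k = subst (j <_) eq (s≤s (m≤n+m j d))

mutual
  eval-sound : ∀ {n} s (p : Rec n) xs {y} → eval s p xs ≡ just y → p [ xs ]⇓ y
  eval-sound s zeroᵣ       []          refl = ⇓zero
  eval-sound s sucᵣ        (x ∷ [])    refl = ⇓suc
  eval-sound s (proj i)    xs          refl = ⇓proj
  eval-sound s (comp f gs) xs          eq with >>=-just⁻ (evals s gs xs) eq
  ... | ys , eqs , eq′ = ⇓comp (evals-sound s gs xs eqs) (eval-sound s f ys eq′)
  eval-sound s (prec f g)  (k ∷ xs)    eq   = prec-sound s f g k xs eq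
  eval-sound s (min f)     xs          eq
    with search-sound (λ k → eval s f (k ∷ xs)) s 0 eq (λ ())
  ... | fk , below =
    ⇓min (eval-sound s f _ fk) (λ i<k → _ , eval-sound s f _ (proj₂ (below i<k)))

  prec-sound : ∀ {n} s (f : Rec n) g k xs {y} →
               eval s (prec f g) (k ∷ xs) ≡ just y → prec f g [ k ∷ xs ]⇓ y
  prec-sound s f g zero    xs eq = ⇓prec₀ (eval-sound s f xs eq)
  prec-sound s f g (suc k) xs eq with >>=-just⁻ (eval s (prec f g) (k ∷ xs)) eq
  ... | r , eqr , eq′ = ⇓prec₊ (prec-sound s f g k xs eqr) (eval-sound s g (k ∷ r ∷ xs) eq′)

  evals-sound : ∀ {m n} s (gs : Vec (Rec n) m) xs {ys} →
                evals s gs xs ≡ just ys → Pointwise (λ g y → g [ xs ]⇓ y) gs ys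
  evals-sound s []       xs refl = []
  evals-sound s (g ∷ gs) xs eq with >>=-just⁻ (eval s g xs) eq
  ... | y , eqy , eq′ with >>=-just⁻ (evals s gs xs) eq′
  ... | ys , eqs , refl = eval-sound s g xs eqy ∷ evals-sound s gs xs eqs

-- Completeness of evaluation for all large fuel.

Eventually : Pred ℕ 0ℓ → Set
Eventually P = ∃[ s₀ ] ∀ s → s₀ ≤ s → P s

-- `Eventually` speaks of all large `s` rather than of some `s`, so that the maximum of two
-- thresholds serves both.
eventually-∧ : ∀ {P Q R : Pred ℕ 0ℓ} → (∀ {s} → P s → Q s → R s) →
               Eventually P → Eventually Q → Eventually R
eventually-∧ h (a , p) (b , q) = a ⊔ b , λ s ab≤s →
  h (p s (m⊔n≤o⇒m≤o a b ab≤s)) (q s (m⊔n≤o⇒n≤o a b ab≤s))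

-- Supplies one fuel bound for the finitely many values below the zero found by `min`.
eventually-below : ∀ {P : ℕ → Pred ℕ 0ℓ} k → (∀ {j} → j < k → Eventually (P j)) →
                   Eventually (λ s → ∀ {j} → j < k → P j s)
eventually-below zero    _ = 0 , λ _ _ ()
eventually-below {P} (suc k) h =
  eventually-∧ combine (eventually-below k (λ j<k → h (m<n⇒m<1+n j<k))) (h (n<1+n k))
  where
  combine : ∀ {s} → (∀ {j} → j < k → P j s) → P k s → ∀ {j} → j < suc k → P j s
  combine below at (s≤s j≤k) with m≤n⇒m<n∨m≡n j≤k
  ... | inj₁ j<k  = below j<k
  ... | inj₂ refl = at

mutual
  eval-complete : ∀ {n} {p : Rec n} {xs y} → p [ xs ]⇓ y → Eventually (λ s → eval s p xs ≡ just y)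
  eval-complete ⇓zero        = 0 , λ _ _ → refl
  eval-complete ⇓suc         = 0 , λ _ _ → refl
  eval-complete ⇓proj        = 0 , λ _ _ → refl
  eval-complete (⇓comp ds d) = eventually-∧ >>=-just⁺ (evals-complete ds) (eval-complete d)
  eval-complete (⇓prec₀ d)   = eval-complete d
  eval-complete (⇓prec₊ d e) = eventually-∧ >>=-just⁺ (eval-complete d) (eval-complete e)
  eval-complete (⇓min {f = f} {xs} {k} d h) =
    eventually-∧
      (λ (k<s , fk) below → search-complete _ fk (λ i<k → below i<k) k 0 (+-identityʳ k) _ k<s)
      -- The search tests the indices from 0 through `k`, so its fuel must be at least `k + 1`.
      (eventually-∧ _,_ (suc k , λ _ k<s → k<s) (eval-complete d))
      (eventually-below k λ j<k →
        let s₀ , eq = eval-complete (proj₂ (h j<k)) in s₀ , λ s s₀≤s → _ , eq s s₀≤s)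

  evals-complete : ∀ {m n} {gs : Vec (Rec n) m} {xs ys} →
                   Pointwise (λ g y → g [ xs ]⇓ y) gs ys → Eventually (λ s → evals s gs xs ≡ just ys)
  evals-complete []       = 0 , λ _ _ → refl
  evals-complete (d ∷ ds) =
    eventually-∧ (λ eq eqs → >>=-just⁺ eq (>>=-just⁺ eqs refl)) (eval-complete d) (evals-complete ds)

-- Finite stages of a c.e. set.

record Stages (A : Pred ℕ 0ℓ) : Set where
  field
    stage    : ℕ → List ℕ
    sound    : ∀ {n x} → x ∈ˡ stage n → x ∈ A
    complete : ∀ {x} → x ∈ A → ∃[ n ] x ∈ˡ stage n

-- Dovetailing: `s` bounds both the inputs tried and the fuel.
dom-stages : ∀ p → Stages (Dom p)
dom-stages p = record
  { stage    = λ s → filter (λ x → T? (halts s x)) (upTo s)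
  ; sound    = λ {s} x∈ → halts-sound s (proj₂ (∈-filter⁻ (λ x → T? (halts s x)) {xs = upTo s} x∈))
  ; complete = λ {x} (_ , d) →
      let s₀ , eq = eval-complete d
          -- The fuel must reach the threshold for `x`, and `upTo s` contains `x` only if `x < s`.
          s       = s₀ ⊔ suc x
          ev      = eq s (m≤m⊔n s₀ (suc x))
      in s , ∈-filter⁺ (λ x → T? (halts s x)) (∈-upTo⁺ (m≤n⊔m s₀ (suc x)))
               (subst (λ m → T (is-just m)) (sym ev) tt)
  }
  where
  halts : ℕ → ℕ → Bool
  halts s x = is-just (eval s p (x ∷ []))
  halts-sound : ∀ s {x} → T (halts s x) → x ∈ Dom p
  halts-sound s {x} h with eval s p (x ∷ []) in eq
  ... | just y = y , eval-sound s p (x ∷ []) eq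

-- Finite lists as infinite sequences.

-- A list as the sequence of its entries followed by zeros.
nth : List ℕ → ℕ → ℕ
nth []       _       = 0
nth (x ∷ xs) zero    = x
nth (x ∷ xs) (suc j) = nth xs j

nth-∈ : ∀ xs j → nth xs j ∈ˡ 0 ∷ xs
nth-∈ []       _       = here refl
nth-∈ (x ∷ xs) zero    = there (here refl)
nth-∈ (x ∷ xs) (suc j) with nth-∈ xs j
... | here eq  = here eq
... | there x∈ = there (there x∈)

∈-nth : ∀ {x xs} → x ∈ˡ xs → ∃[ j ] j < length xs × nth xs j ≡ x
∈-nth (here refl) = 0 , s≤s z≤n , refl
∈-nth (there x∈) with j , j< , eq ← ∈-nth x∈ = suc j , s≤s j< , eq

-- Provides an occurrence of 0 even when the list has none, as needed to enumerate the set of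
-- `0 ∷ ρ`.
nth-length : ∀ xs → nth xs (length xs) ≡ 0
nth-length []       = refl
nth-length (x ∷ xs) = nth-length xs

nth-++ˡ : ∀ xs {ys j} → j < length xs → nth (xs ++ ys) j ≡ nth xs j
nth-++ˡ (x ∷ xs) {j = zero}  _        = refl
nth-++ˡ (x ∷ xs) {j = suc j} (s≤s j<) = nth-++ˡ xs j<

nth-applyUpTo : ∀ f {s j} → j < s → nth (applyUpTo f s) j ≡ f j
nth-applyUpTo f {suc s} {zero}  _        = refl
nth-applyUpTo f {suc s} {suc j} (s≤s j<) = nth-applyUpTo (λ i → f (suc i)) j<

applyUpTo-nth : ∀ {f} xs → (∀ {j} → j < length xs → f j ≡ nth xs j) →
                applyUpTo f (length xs) ≡ xs
applyUpTo-nth []       _ = refl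
applyUpTo-nth (x ∷ xs) h = cong₂ _∷_ (h (s≤s z≤n)) (applyUpTo-nth xs (λ j< → h (s≤s j<)))

-- The padded enumeration as a limit of finite parts.

-- The enumeration of A that pads each finite part with s ρ − |ρ| zeros before
-- the next stage of A is listed.
module Padding {A : Pred ℕ 0ℓ} (0∈A : 0 ∈ A) (stages : Stages A)
               (s : List ℕ → ℕ) (s-long : ∀ ρ → length ρ < s ρ) where
  open Stages stages

  pad : List ℕ → List ℕ
  pad ρ = applyUpTo (nth ρ) (s ρ)

  unpadded : ℕ → List ℕ
  part     : ℕ → List ℕ
  unpadded zero    = []
  unpadded (suc n) = part n ++ stage n
  part n = pad (unpadded n)

  unpadded<part : ∀ n → length (unpadded n) < length (part n)
  unpadded<part n = subst (length (unpadded n) <_) (sym (length-applyUpTo _ _)) (s-long (unpadded n))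

  part-grows : ∀ n → length (part n) < length (part (suc n))
  part-grows n = ≤-<-trans (length-++-≤ˡ (part n)) (unpadded<part (suc n))

  -- Each padding adds at least one zero by `s-long`, so the parts lengthen even when a stage
  -- contributes nothing.
  n<part : ∀ n → n < length (part n)
  n<part zero    = ≤-<-trans z≤n (unpadded<part zero)
  n<part (suc n) = ≤-<-trans (n<part n) (part-grows n)

  nth-pad : ∀ ρ {j} → j < length ρ → nth (pad ρ) j ≡ nth ρ j
  nth-pad ρ j< = nth-applyUpTo (nth ρ) (<-trans j< (s-long ρ))

  nth-part-suc : ∀ n {j} → j < length (part n) → nth (part (suc n)) j ≡ nth (part n) j
  nth-part-suc n j< =
    trans (nth-pad (unpadded (suc n)) (<-≤-trans j< (length-++-≤ˡ (part n)))) (nth-++ˡ (part n) j<)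

  part-mono : ∀ d n → length (part n) ≤ length (part (d + n))
  part-mono zero    n = ≤-refl
  part-mono (suc d) n = ≤-trans (part-mono d n) (<⇒≤ (part-grows (d + n)))

  nth-part-+ : ∀ d n {j} → j < length (part n) → nth (part (d + n)) j ≡ nth (part n) j
  nth-part-+ zero    n j< = refl
  nth-part-+ (suc d) n j< =
    trans (nth-part-suc (d + n) (<-≤-trans j< (part-mono d n))) (nth-part-+ d n j<)

  nth-part-≤ : ∀ {m n j} → m ≤ n → j < length (part m) → nth (part n) j ≡ nth (part m) j
  nth-part-≤ {m} {j = j} m≤n j< with d , refl ← m≤n⇒∃[o]m+o≡n m≤n =
    trans (cong (λ k → nth (part k) j) (+-comm m d)) (nth-part-+ d m j<)

  -- The limit of the parts: each is a prefix of the next, and `part j` is long enough to have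
  -- settled position `j`.
  enum : ℕ → ℕ
  enum j = nth (part j) j

  enum-part : ∀ n {j} → j < length (part n) → enum j ≡ nth (part n) j
  enum-part n {j} j< with ≤-total j n
  ... | inj₁ j≤n = sym (nth-part-≤ j≤n (n<part j))
  ... | inj₂ n≤j = nth-part-≤ n≤j j<

  -- The limit runs through every padded string, so what a learner answers on `part n` is an answer
  -- it gives along `enum`.
  enum-prefix : ∀ n → applyUpTo enum (length (part n)) ≡ part n
  enum-prefix n = applyUpTo-nth (part n) (enum-part n)

  nth-⊆ : ∀ {ρ} → All (_∈ A) ρ → ∀ j → nth ρ j ∈ A
  nth-⊆ {ρ} ρ⊆A j = All.lookup (0∈A ∷ ρ⊆A) (nth-∈ ρ j)

  unpadded-⊆ : ∀ n → All (_∈ A) (unpadded n)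
  part-⊆     : ∀ n → All (_∈ A) (part n)
  unpadded-⊆ zero    = []
  unpadded-⊆ (suc n) = All.++⁺ (part-⊆ n) (All.tabulate sound)
  part-⊆ n = All.applyUpTo⁺₂ (nth (unpadded n)) (s (unpadded n)) (nth-⊆ (unpadded-⊆ n))

  enum-onto : ∀ {x} → x ∈ A → ∃[ j ] enum j ≡ x
  -- `x` lies in the block after `part n` in `unpadded (suc n)`, and padding leaves its position
  -- unchanged.
  enum-onto x∈A with n , x∈ ← complete x∈A
    with j , j< , eq ← ∈-nth (∈-++⁺ʳ (part n) x∈) =
    j , trans (enum-part (suc n) (<-≤-trans j< (<⇒≤ (unpadded<part (suc n)))))
              (trans (nth-pad (unpadded (suc n)) j<) eq)

  enum-isEnumeration : IsEnumeration enum A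
  enum-isEnumeration = record
    { into = λ j → nth-⊆ (part-⊆ j) j
    ; onto = enum-onto
    }

-- Indices of c.e. sets modulo finite differences.

module _ (N : AcceptableEnumeration) where
  open AcceptableEnumeration N renaming (complete to φ-complete)

  -- Hard-wires `e` into the universal machine, turning an arbitrary index into a term that `eval`
  -- can run and `insertᵣ` can modify.
  sectionᵣ : ℕ → Rec 1
  sectionᵣ e = comp (proj₁ universal) (constᵣ e ∷ proj zero ∷ [])

  W≐section : ∀ e → W N e ≐ Dom (sectionᵣ e)
  W≐section e = to , from
    where
    to : W N e ⊆ Dom (sectionᵣ e)
    to (y , h) = y , ⇓comp (⇓const e ∷ ⇓proj ∷ []) (proj₁ (proj₂ universal e) h)
    from : Dom (sectionᵣ e) ⊆ W N e
    from (y , ⇓comp (c ∷ ⇓proj ∷ []) h) with refl ← const⇓ e c = y , proj₂ (proj₂ universal e) h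

  index : Rec 1 → ℕ
  index p = proj₁ (φ-complete p)

  W-index : ∀ p → W N (index p) ≐ Dom p
  W-index p = (λ (y , h) → y , proj₁ (proj₂ (φ-complete p)) h)
            , (λ (y , h) → y , proj₂ (proj₂ (φ-complete p)) h)

  W-list : ∀ ds → W N (index (listᵣ ds)) ≐ (_∈ˡ ds)
  W-list ds = (λ x∈ → list⁻ ds (proj₁ (W-index _) x∈)) , (λ x∈ → proj₂ (W-index _) (list⁺ x∈))

  W-stages : ∀ e → Stages (W N e)
  W-stages e = record
    { stage    = stage
    ; sound    = λ {n} x∈ → proj₂ (W≐section e) (sound {n} x∈)
    ; complete = λ x∈ → complete (proj₁ (W≐section e) x∈)
    }
    where open Stages (dom-stages (sectionᵣ e))

  adjoin : ℕ → ℕ → ℕ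
  adjoin d e = index (insertᵣ d (sectionᵣ e))

  d∈adjoin : ∀ d e → d ∈ W N (adjoin d e)
  d∈adjoin d e = proj₂ (W-index _) (insert-self d (sectionᵣ e))

  E₀-adjoin : ∀ d e → _E₀_ N e (adjoin d e)
  E₀-adjoin d e = d ∷ [] , λ where
      (inj₁ (x∈ , x∉)) → ⊥-elim (x∉ (proj₂ (W-index _) (insert-old d (proj₁ (W≐section e) x∈))))
      (inj₂ (x∈ , x∉)) → only-d x∉ (insert⁻ d (proj₁ (W-index _) x∈))
    where
    only-d : ∀ {x} → ¬ (x ∈ W N e) → x ≡ d ⊎ x ∈ Dom (sectionᵣ e) → x ∈ˡ d ∷ []
    only-d _  (inj₁ refl) = here refl
    only-d x∉ (inj₂ x∈)   = ⊥-elim (x∉ (proj₂ (W≐section e) x∈))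

  -- `Finite` asks only for a covering list, so the concatenation bounds both differences.
  E₀-lists : ∀ ds ds′ → _E₀_ N (index (listᵣ ds)) (index (listᵣ ds′))
  E₀-lists ds ds′ = ds ++ ds′ , λ where
    (inj₁ (x∈ , _)) → ∈-++⁺ˡ (proj₁ (W-list ds) x∈)
    (inj₂ (x∈ , _)) → ∈-++⁺ʳ ds (proj₁ (W-list ds′) x∈)

  nonemptyCE : Family N
  nonemptyCE = record
    { member   = λ A → Satisfiable A × IsCE N A
    ; resp     = λ { (A⊆B , B⊆A) ((x , x∈A) , e , A⊆W , W⊆A) →
                     (x , A⊆B x∈A) , e , (λ b → A⊆W (B⊆A b)) , (λ w → A⊆B (W⊆A w)) }
    ; ce       = proj₂
    ; nonempty = proj₁
    }

  -- Fooling the learner.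

  module _ {ℓ} (F : CERelation N ℓ) (E₀⇒F : _E₀_ N ⇒ CERelation.rel F)
           (learnable : Learnable N F nonemptyCE) where
    open CERelation F
    open IsEquivalence isEquivalence using () renaming (sym to F-sym; trans to F-trans)

    M : Learner
    M = proj₁ learnable

    -- Reference point in the `F`-class of the finite sets; the empty set itself is not in
    -- `nonemptyCE`.
    ∅ : ℕ
    ∅ = index (listᵣ [])

    W-member : ∀ e {x} → x ∈ W N e → Family.member nonemptyCE (W N e)
    W-member e x∈ = (_ , x∈) , e , (λ w → w) , (λ w → w)

    nth-isEnumeration : ∀ ρ → IsEnumeration (nth ρ) (W N (index (listᵣ (0 ∷ ρ))))
    nth-isEnumeration ρ = record
      { into = λ j → proj₂ (W-list (0 ∷ ρ)) (nth-∈ ρ j)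
      ; onto = λ x∈ → onto′ (proj₁ (W-list (0 ∷ ρ)) x∈)
      }
      where
      onto′ : ∀ {x} → x ∈ˡ 0 ∷ ρ → ∃[ j ] nth ρ j ≡ x
      onto′ (here refl) = length ρ , nth-length ρ
      onto′ (there x∈) with j , _ , eq ← ∈-nth x∈ = j , eq

    -- `nth ρ` enumerates a finite set, on which `M` must settle; `E₀-lists` then carries its answer
    -- to `∅`.
    fooled : ∀ ρ → ∃[ s ] length ρ < s × rel (M (applyUpTo (nth ρ) s)) ∅
    fooled ρ
      with i , iFe , s₀ , eq ← proj₂ learnable _
             (W-member _ (proj₂ (W-list (0 ∷ ρ)) (here refl))) (nth ρ) (nth-isEnumeration ρ) =
      -- The maximum waits until `M` has settled and `ρ` is listed with at least one zero after it.
      s₀ ⊔ suc (length ρ) , m≤n⊔m s₀ _ ,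
      subst (λ k → rel k ∅) (sym (eq _ (m≤m⊔n s₀ _))) (F-trans iFe (E₀⇒F (E₀-lists (0 ∷ ρ) [])))

    containing-0-related-∅ : ∀ e → 0 ∈ W N e → rel e ∅
    containing-0-related-∅ e 0∈W =
      let i , iFe , s₀ , eq = proj₂ learnable e (W-member e 0∈W) enum enum-isEnumeration
          -- `part s₀` has more than `s₀` entries, so `M` has already settled on `i` there.
          M-part : M (part s₀) ≡ i
          M-part = trans (cong M (sym (enum-prefix s₀))) (eq _ (<⇒≤ (n<part s₀)))
      -- `part s₀` unfolds to the very string on which `fooled` evaluates `M`, so `i` is related to
      -- `∅` as well as to `e`.
      in F-trans (F-sym iFe) (subst (λ k → rel k ∅) M-part (proj₂ (proj₂ (fooled (unpadded s₀)))))
      where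
      -- Each `ρ` is padded up to the length at which `fooled` catches `M`.
      open Padding 0∈W (W-stages e) (λ ρ → proj₁ (fooled ρ)) (λ ρ → proj₁ (proj₂ (fooled ρ)))

    related-∅ : ∀ e → rel e ∅
    related-∅ e =
      F-trans (E₀⇒F (E₀-adjoin 0 e)) (containing-0-related-∅ (adjoin 0 e) (d∈adjoin 0 e))

    related : ∀ a b → rel a b
    related a b = F-trans (related-∅ a) (F-sym (related-∅ b))

theorem5p3 : (N : AcceptableEnumeration) (ℓ : Level) → Weak N ℓ (E₀ᶜᵉ N)
theorem5p3 N ℓ F E₀⇒F F-universal =
  (λ _ → tt) , (λ {a} {b} _ → related N F (λ {a} {b} → E₀⇒F {a} {b}) (F-universal (nonemptyCE N)) a b)
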